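{- Let $\lambda>\mathrm{cf}(\lambda)=\aleph_0$ be a Magidor cardinal, let $S=S^\lambda_\omega=\{\eta<\lambda:\mathrm{cf}(\eta)=\omega\}$, and let $\alpha_M<\lambda$ be the least ordinal $\alpha$ with $\lambda\rightarrow[\lambda]^{\aleph_0\text{ -bd}}_\alpha$. Then $\pitchfork_{S,\delta}$ fails for every regular cardinal $\delta$ with $\alpha_M\le\delta<\lambda$.
   Context: Work in ZFC. For a cardinal $\lambda$, $[\lambda]^{\aleph_0\text{ -bd}}$ denotes the set of countably infinite subsets of $\lambda$ bounded in $\lambda$, $[\lambda]^\lambda$ the subsets of $\lambda$ of size $\lambda$. For an ordinal $\theta$, $\lambda\rightarrow[\lambda]^{\aleph_0\text{ -bd}}_\theta$ means: for every $c:[\lambda]^{\aleph_0\text{ -bd}}\to\theta$ there is $A\in[\lambda]^\lambda$ with $c''[A]^{\aleph_0\text{ -bd}}\neq\theta$. A cardinal $\lambda$ with $\mathrm{cf}(\lambda)=\aleph_0$ is a Magidor cardinal iff $\lambda\rightarrow[\lambda]^{\aleph_0\text{ -bd}}_\lambda$. Quilshon: for a regular $\delta<\lambda$ and an unbounded $S\subseteq\lambda$, $\pitchfork_{S,\delta}$ holds iff there is a family $\{S_\gamma:\gamma<\delta\}$ of pairwise disjoint subsets of $S$ such that for every ordinal $\eta<\lambda$ with $\mathrm{cf}(\eta)=\delta$ and every $\gamma<\delta$, the set $S_\gamma\cap\eta$ is a stationary subset of $\eta$. $\pitchfork_{\lambda,\delta}$ is the case $S=\lambda$. -}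

module Defs where

open import Data.Nat.Base using (ℕ)
import Data.Nat.Base as ℕ
import Data.Nat.Induction as ℕ
import Data.Nat.Properties as ℕ
open import Data.Product.Base using (Σ; Σ-syntax; ∃-syntax; _×_; _,_; proj₁; proj₂)
open import Data.Refinement.Base using (Refinement-syntax; value)
open import Data.Refinement.Properties using (value-injective)
open import Function.Base using (_on_)
open import Function.Bundles using (_⤖_; _↣_; Func)
open import Induction.WellFounded using (WellFounded)
open import Level using (Level; _⊔_; 0ℓ) renaming (suc to lsuc)
open import Relation.Binary.Bundles using (Setoid)
open import Relation.Binary.Core using (Rel)
import Relation.Binary.Construct.On as On
import Relation.Binary.Construct.StrictToNonStrict as StrictToNonStrict
open import Relation.Binary.Definitions using (Trichotomous; tri<; tri≈; tri>)
open import Relation.Binary.Morphism.Structures using (IsOrderIsomorphism)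
open import Relation.Binary.PropositionalEquality
  using (_≡_; _≢_; refl; isEquivalence; resp₂; setoid)
open import Relation.Binary.Structures
  using (IsStrictTotalOrder)
open import Relation.Nullary.Negation.Core using (¬_)
open import Relation.Unary using (Pred; _∈_; _⊆_; _≐_; _⊥_; U)
open import Relation.Unary.Relation.Binary.Equality using (≐-setoid)

private
  variable
    a p ℓ ℓ₁ ℓ₂ : Level

------------------------------------------------------------------------
-- Ordinals
--
-- An ordinal is a well-ordered type, considered up to order isomorphism.
-- The ordinals below O are its elements x, identified with the initial
-- segments O ↓ x.  Subsets of O are predicates; in the presence of excluded
-- middle these are all the subsets, at any universe level.  Excluded middle
-- for (untruncated) types, as in Axiom.ExcludedMiddle, also supplies the axiom
-- of choice.

record Ordinal (ℓ : Level) : Set (lsuc ℓ) where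
  infix 4 _<_
  field
    Carrier            : Set ℓ
    _<_                : Rel Carrier ℓ
    isStrictTotalOrder : IsStrictTotalOrder _≡_ _<_
    <-wellFounded      : WellFounded _<_

  open IsStrictTotalOrder isStrictTotalOrder public using (compare; trans; irrefl)
  open StrictToNonStrict _≡_ _<_ public using (_≤_)

open Ordinal using (Carrier)

ω : Ordinal 0ℓ
ω = record
  { Carrier            = ℕ
  ; _<_                = ℕ._<_
  ; isStrictTotalOrder = ℕ.<-isStrictTotalOrder
  ; <-wellFounded      = ℕ.<-wellFounded
  }

infixl 7 _↓_

_↓_ : (O : Ordinal ℓ) → Carrier O → Ordinal ℓ
O ↓ η = record
  { Carrier            = Seg
  ; _<_                = _<_ on value
  ; isStrictTotalOrder = record
    { isStrictPartialOrder = record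
      { isEquivalence = isEquivalence
      ; irrefl        = λ { refl → irrefl refl }
      ; trans         = trans
      ; <-resp-≈      = resp₂ (_<_ on value)
      }
    ; compare = cmp
    }
  ; <-wellFounded      = On.wellFounded value (Ordinal.<-wellFounded O)
  }
  where
  open Ordinal O hiding (Carrier)
  Seg = [ x ∈ Carrier O ∣ x < η ]

  cmp : Trichotomous {A = Seg} _≡_ (_<_ on value)
  cmp x y with compare (value x) (value y)
  ... | tri< l ne g = tri< l (λ { refl → ne refl }) g
  ... | tri≈ l eq g = tri≈ l (value-injective eq) g
  ... | tri> l ne g = tri> l (λ { refl → ne refl }) g

-- Strict inequality between ordinals.
infix 4 _≺_

_≺_ : Ordinal ℓ₁ → Ordinal ℓ₂ → Set (ℓ₁ ⊔ ℓ₂)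
O ≺ P = ∃[ η ] Σ[ f ∈ (Carrier O → Carrier (P ↓ η)) ]
  IsOrderIsomorphism _≡_ _≡_ (Ordinal._<_ O) (Ordinal._<_ (P ↓ η)) f

-- A cardinal is an initial ordinal.
IsCardinal : Ordinal ℓ → Set ℓ
IsCardinal O = ∀ η → ¬ (Carrier (O ↓ η) ⤖ Carrier O)

-- A ⊆ X has the same cardinality as B.  Membership is irrelevant in the
-- refinement type, so it has exactly one element for each element of A.
HasSize : {X : Set a} → Pred X p → {b : Level} → Set b → Set (a ⊔ p ⊔ b)
HasSize {X = X} A B = [ x ∈ X ∣ x ∈ A ] ⤖ B

module _ (O : Ordinal ℓ) where
  open Ordinal O using (_<_; _≤_)

  Bounded : Pred (Carrier O) p → Set (ℓ ⊔ p)
  Bounded A = ∃[ b ] (∀ {x} → x ∈ A → x < b)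

  Unbounded : Pred (Carrier O) p → Set (ℓ ⊔ p)
  Unbounded A = ∀ b → ∃[ x ] x ∈ A × b ≤ x

  -- Every limit β < O which is a limit of points of A belongs to A; that β is
  -- a limit ordinal follows from the last two conditions.
  Closed : Pred (Carrier O) p → Set (ℓ ⊔ p)
  Closed A = ∀ β → (∃[ y ] y < β) →
    (∀ y → y < β → ∃[ x ] x ∈ A × y < x × x < β) → β ∈ A

  Stationary : Pred (Carrier O) ℓ → Set (lsuc ℓ)
  Stationary T = ∀ (C : Pred (Carrier O) ℓ) → Unbounded C → Closed C →
    ∃[ x ] x ∈ T × x ∈ C

CofinalMap : Ordinal ℓ₁ → Ordinal ℓ₂ → Set (ℓ₁ ⊔ ℓ₂)
CofinalMap D O = Σ[ f ∈ (Carrier D → Carrier O) ]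
  (∀ y → ∃[ ξ ] Ordinal._≤_ O y (f ξ))

-- cf(O) = D: D is the least ordinal admitting a map into O with unbounded
-- range.
HasCofinality : Ordinal ℓ₁ → Ordinal ℓ₂ → Set (ℓ₁ ⊔ ℓ₂)
HasCofinality O D = CofinalMap D O × (∀ ξ → ¬ CofinalMap (D ↓ ξ) O)

IsRegularCardinal : Ordinal ℓ → Set ℓ
IsRegularCardinal D = IsCardinal D × (ℕ ↣ Carrier D) × HasCofinality D D

------------------------------------------------------------------------
-- Square bracket relations and Magidor cardinals

module _ (κ : Ordinal ℓ) where

  IsBddCtbl : Pred (Carrier κ) ℓ → Set ℓ
  IsBddCtbl x = HasSize x ℕ × Bounded κ x

  -- The countably infinite bounded subsets of κ, with extensional equality.
  BddCtbl : Setoid (lsuc ℓ) ℓ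
  BddCtbl = On.setoid {B = Σ (Pred (Carrier κ) ℓ) IsBddCtbl}
    (≐-setoid (Carrier κ) ℓ) proj₁

  Colouring : Ordinal ℓ₁ → Set (lsuc ℓ ⊔ ℓ₁)
  Colouring Θ = Func BddCtbl (setoid (Carrier Θ))

  colours : {Θ : Ordinal ℓ₁} → Colouring Θ → Pred (Carrier κ) ℓ →
            Pred (Carrier Θ) (lsuc ℓ ⊔ ℓ₁)
  colours c A θ = ∃[ x ] proj₁ x ⊆ A × Func.to c x ≡ θ

  Arrows : Ordinal ℓ₁ → Set (lsuc ℓ ⊔ ℓ₁)
  Arrows Θ = ∀ (c : Colouring Θ) → Σ[ A ∈ Pred (Carrier κ) ℓ ]
    HasSize A (Carrier κ) × ¬ (colours {Θ = Θ} c A ≐ U)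

  IsMagidor : Set (lsuc ℓ)
  IsMagidor = IsCardinal κ × HasCofinality κ ω × Arrows κ

  -- α is the least nonzero ordinal with Arrows α.  Zero has to be excluded:
  -- there is no colouring with values in the empty set, so Arrows 0 holds
  -- vacuously.
  IsLeastArrowed : Carrier κ → Set (lsuc ℓ)
  IsLeastArrowed α =
    NonZero α × Arrows (κ ↓ α) × (∀ β → β < α → NonZero β → ¬ Arrows (κ ↓ β))
    where
    open Ordinal κ using (_<_)
    NonZero : Carrier κ → Set ℓ
    NonZero β = ∃[ ξ ] ξ < β

------------------------------------------------------------------------
-- Quilshon

  CofinalityOmega : Pred (Carrier κ) ℓ
  CofinalityOmega η = HasCofinality (κ ↓ η) ω

  -- Meant for unbounded S and regular δ.
  Quilshon : Pred (Carrier κ) ℓ → Carrier κ → Set (lsuc ℓ)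
  Quilshon S δ = Σ[ T ∈ (Carrier (κ ↓ δ) → Pred (Carrier κ) ℓ) ]
    (∀ γ → T γ ⊆ S) ×
    (∀ γ γ′ → γ ≢ γ′ → T γ ⊥ T γ′) ×
    (∀ η → HasCofinality (κ ↓ η) (κ ↓ δ) → ∀ γ →
      Stationary (κ ↓ η) (λ x → value x ∈ T γ))

{-# OPTIONS --safe #-}

-- Suppose the sets T γ (γ < δ) witness quilshon, and colour a countable set x
-- by the γ < αM with sup x ∈ T γ, if there is one.  The arrow relation for αM
-- yields a set A of size κ omitting some colour γ.  Let η be the supremum of
-- the first δ elements of A, so that cf η = δ.  If δ is uncountable, then the
-- limit points of A below η are a club in η, hence one of them, β, lies in T γ;
-- as cf β = ω, some x ⊆ A of order type ω has supremum β and colour γ, a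
-- contradiction.  If ω is cofinal in δ, then δ has no element of cofinality ω,
-- and T γ cannot meet the club of all ordinals below δ.
module Submission where

open import Defs
open import Level using (Level; _⊔_)
open import Axiom.ExcludedMiddle using (ExcludedMiddle)
open import Axiom.DoubleNegationElimination using (em⇒dne)
open import Data.Irrelevant using ([_])
open import Data.Nat.Base using (ℕ; zero; suc)
import Data.Nat.Base as ℕ
import Data.Nat.Properties as ℕ
open import Data.Product.Base using (Σ-syntax; ∃; ∃-syntax; _×_; _,_; proj₁; proj₂; swap)
open import Data.Refinement.Base using (Refinement-syntax; value; refine; _,_)
open import Data.Refinement.Properties using (value-injective)
open import Data.Sum.Base using (inj₁; inj₂)
open import Data.Unit.Polymorphic.Base using (⊤)
open import Function.Base using (_∘_)
open import Function.Bundles using (_⤖_; mk⤖)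
open import Function.Consequences.Propositional using (strictlySurjective⇒surjective)
open import Function.Construct.Composition using (_⤖-∘_)
open import Function.Construct.Symmetry using (⤖-sym)
open import Function.Definitions using (Injective)
open import Induction.WellFounded using (module All; module FixPoint; WfRec)
open import Relation.Binary.Core using (Rel; _Preserves_⟶_)
open import Relation.Binary.Definitions
  using (Transitive; Trans; Antisymmetric; tri<; tri≈; tri>)
open import Relation.Binary.PropositionalEquality
  using (_≡_; refl; sym; subst; cong)
open import Relation.Nullary.Decidable.Core using (yes; no; recompute)
open import Relation.Nullary.Negation.Core using (¬_; contradiction)
open import Relation.Unary using (Pred; _∈_; _⊆_; _≐_)

open Ordinal using (Carrier)

private
  variable
    a p q ℓ ℓ₁ ℓ₂ : Level

-- Order, suprema and cofinal maps in well-orders.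

mono-from-steps : {X : Set a} (_R_ : Rel X ℓ) → Transitive _R_ → {h : ℕ → X} →
  (∀ n → h n R h (suc n)) → ∀ {m n} → m ℕ.< n → h m R h n
mono-from-steps _R_ R-trans {h} step m<n = go (ℕ.≤⇒≤′ m<n)
  where
  go : ∀ {m n} → suc m ℕ.≤′ n → h m R h n
  go {m} (ℕ.<′-base)  = step m
  go (ℕ.≤′-step sm≤n) = R-trans (go sm≤n) (step _)

module _ (O : Ordinal ℓ) where
  open Ordinal O renaming (Carrier to X)

  ≮⇒≥ : ∀ {x y} → ¬ (x < y) → y ≤ x
  ≮⇒≥ {x} {y} x≮y with compare x y
  ... | tri< x<y _ _   = contradiction x<y x≮y
  ... | tri≈ _ refl _  = inj₂ refl
  ... | tri> _ _ y<x   = inj₁ y<x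

  ≤-<-trans : Trans _≤_ _<_ _<_
  ≤-<-trans (inj₁ x<y)  y<z = trans x<y y<z
  ≤-<-trans (inj₂ refl) y<z = y<z

  <-≤-trans : Trans _<_ _≤_ _<_
  <-≤-trans x<y (inj₁ y<z)  = trans x<y y<z
  <-≤-trans x<y (inj₂ refl) = x<y

  ≤-trans : Transitive _≤_
  ≤-trans (inj₁ x<y)  y≤z = inj₁ (<-≤-trans x<y y≤z)
  ≤-trans (inj₂ refl) y≤z = y≤z

  ≤⇒≯ : ∀ {x y} → x ≤ y → ¬ (y < x)
  ≤⇒≯ x≤y y<x = irrefl refl (≤-<-trans x≤y y<x)

  ≤-antisym : Antisymmetric _≡_ _≤_
  ≤-antisym (inj₁ x<y)  y≤x = contradiction x<y (≤⇒≯ y≤x)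
  ≤-antisym (inj₂ refl) _   = refl

  upperBound : ∀ x y → ∃[ z ] x ≤ z × y ≤ z
  upperBound x y with compare x y
  ... | tri< x<y _ _  = y , inj₁ x<y , inj₂ refl
  ... | tri≈ _ refl _ = y , inj₂ refl , inj₂ refl
  ... | tri> _ _ y<x  = x , inj₂ refl , inj₁ y<x

  IsLeast : Pred X p → Pred X (ℓ ⊔ p)
  IsLeast P x = x ∈ P × (∀ {y} → y ∈ P → x ≤ y)

  least-unique : {P : Pred X p} {Q : Pred X q} → P ≐ Q →
    ∀ {x y} → IsLeast P x → IsLeast Q y → x ≡ y
  least-unique (P⊆Q , Q⊆P) (Px , x≤) (Qy , y≤) = ≤-antisym (x≤ (Q⊆P Qy)) (y≤ (P⊆Q Px))

  -- The supremum if the range has no largest element; otherwise the successor of that element.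
  StrictSup : {I : Set a} → (I → X) → Pred X (ℓ ⊔ a)
  StrictSup f = IsLeast (λ y → ∀ i → f i < y)

  -- The least ordinal qualifies vacuously. This does no harm: the limit points put to use lie in
  -- some `T γ` and so have cofinality ω.
  LimitPoint : Pred X p → Pred X (ℓ ⊔ p)
  LimitPoint A z = ∀ {y} → y < z → ∃[ a ] a ∈ A × y < a × a < z

  LimitSup : Pred X p → Pred X (ℓ ⊔ p)
  LimitSup A z = (∀ {y} → y ∈ A → y < z) × (∀ {y} → y < z → ∃[ a ] a ∈ A × y < a)

  limitSup-unique : {A : Pred X p} → ∀ {x y} → LimitSup A x → LimitSup A y → x ≡ y
  limitSup-unique {A = A} supx supy = ≤-antisym (below supx supy) (below supy supx)
    where
    below : ∀ {x y} → LimitSup A x → LimitSup A y → x ≤ y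
    below (_ , cofinal) (bound , _) = ≮⇒≥ λ y<x →
      let (_ , a∈A , y<a) = cofinal y<x in irrefl refl (trans y<a (bound a∈A))

  inclusion : ∀ {α β} → α ≤ β → Carrier (O ↓ α) → Carrier (O ↓ β)
  inclusion α≤β = refine (λ x<α → <-≤-trans x<α α≤β)

-- Serves to re-index: a segment of a segment is only isomorphic to the corresponding segment, not
-- equal to it.
cofinalMap-∘-surjective : (Q : Ordinal ℓ) (P : Ordinal ℓ₁) (D : Ordinal ℓ₂) →
  CofinalMap P D → (s : Carrier Q → Carrier P) → (∀ y → ∃[ x ] s x ≡ y) →
  CofinalMap Q D
cofinalMap-∘-surjective _ _ D (f , cofinal) s surj = f ∘ s , λ y →
  let (ξ , y≤fξ) = cofinal y
      (x , sx≡ξ) = surj ξ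
  in x , subst (λ ζ → Ordinal._≤_ D y (f ζ)) (sym sx≡ξ) y≤fξ

-- Excluded middle, least elements and limit points.

module Classical (em : ∀ {a : Level} → ExcludedMiddle a) where

  dne : {P : Set p} → ¬ ¬ P → P
  dne = em⇒dne em

  ¬∀⇒∃¬ : {X : Set a} {P : Pred X p} → ¬ (∀ x → P x) → ∃[ x ] ¬ P x
  ¬∀⇒∃¬ ¬∀ = dne λ ¬∃ → ¬∀ λ x → dne λ ¬Px → ¬∃ (x , ¬Px)

  -- Membership in a refinement is irrelevant; decidability from `em` recovers a usable proof.
  satisfies : {X : Set a} {P : Pred X p} (x : [ x ∈ X ∣ P x ]) → P (value x)
  satisfies (_ , [ Px ]) = recompute em Px

  module _ (O : Ordinal ℓ) where
    open Ordinal O renaming (Carrier to X)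

    least : {P : Pred X p} → ∃ P → ∃ (IsLeast O P)
    least {P = P} (x , Px) = wfRec (λ x → P x → ∃ (IsLeast O P)) step x Px
      where
      open All <-wellFounded _ using (wfRec)
      step : ∀ x → WfRec _<_ (λ x → P x → ∃ (IsLeast O P)) x → P x → ∃ (IsLeast O P)
      step x IH Px with em {P = ∃[ y ] y < x × P y}
      ... | yes (y , y<x , Py) = IH y<x Py
      ... | no ¬below = x , Px , λ Py → ≮⇒≥ O λ y<x → ¬below (_ , y<x , Py)

    strictSup-cofinal : {I : Set a} {f : I → X} {s : X} → StrictSup O f s →
      ∀ {y} → y < s → ∃[ i ] y ≤ f i
    strictSup-cofinal (_ , s≤) y<s =
      let (i , fi≮y) = ¬∀⇒∃¬ (λ f<y → ≤⇒≯ O (s≤ f<y) y<s) in i , ≮⇒≥ O fi≮y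

    limitPoints-closed : ∀ η (A : Pred X p) → Closed (O ↓ η) (LimitPoint O A ∘ value)
    limitPoints-closed η A β _ limit {y} y<β =
      let (x , x∈C , y<x , x<β) = limit (y , [ trans y<β (satisfies β) ]) y<β
          (a , a∈A , y<a , a<x) = x∈C y<x
      in a , a∈A , y<a , trans a<x x<β

    -- Since `f` is cofinal in `β` and `A` accumulates at `β`, one can climb through `A` below `β`,
    -- passing each `f n` in turn; the points chosen form an increasing ω-sequence with supremum
    -- `β`.
    limitPoint⇒limitSup : (A : Pred X p) {β : X} → LimitPoint O A β →
      HasCofinality (O ↓ β) ω →
      Σ[ x ∈ Pred X ℓ ] HasSize x ℕ × x ⊆ A × LimitSup O x β
    limitPoint⇒limitSup A {β} limit ((f , f-cofinal) , _) =
      x , ⤖-sym ℕ⤖x , (λ { (n , refl) → proj₁ (proj₂ (h n)) }) ,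
      (λ { (n , refl) → proj₂ (proj₂ (h n)) }) , x-cofinal
      where
      next : ∀ n {y} → y < β → ∃[ a ] (a ∈ A × a < β) × y < a × value (f n) < a
      next n {y} y<β with upperBound (O ↓ β) (y , [ y<β ]) (f n)
      ... | z , y≤z , fn≤z with limit (satisfies z)
      ... | a , a∈A , z<a , a<β =
        let a′ = (a , [ a<β ])
        in a , (a∈A , a<β) , ≤-<-trans (O ↓ β) {k = a′} y≤z z<a
             , ≤-<-trans (O ↓ β) {k = a′} fn≤z z<a

      h : ℕ → Σ[ a ∈ X ] a ∈ A × a < β
      h zero    = let (a , a∈ , _) = next 0 (satisfies (f 0)) in a , a∈
      h (suc n) = let (a , a∈ , _) = next n (proj₂ (proj₂ (h n))) in a , a∈

      h-step : ∀ n → proj₁ (h n) < proj₁ (h (suc n))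
      h-step n = proj₁ (proj₂ (proj₂ (next n (proj₂ (proj₂ (h n))))))

      x : Pred X ℓ
      x a = ∃[ n ] a ≡ proj₁ (h n)

      h-injective : ∀ {m n} → proj₁ (h m) ≡ proj₁ (h n) → m ≡ n
      h-injective {m} {n} eq with ℕ.<-cmp m n
      ... | tri< m<n _ _ =
        contradiction (mono-from-steps _<_ trans {proj₁ ∘ h} h-step m<n) (irrefl eq)
      ... | tri≈ _ m≡n _ = m≡n
      ... | tri> _ _ n<m =
        contradiction (mono-from-steps _<_ trans {proj₁ ∘ h} h-step n<m) (irrefl (sym eq))

      ℕ⤖x : ℕ ⤖ [ a ∈ X ∣ a ∈ x ]
      ℕ⤖x = mk⤖ {to = λ n → proj₁ (h n) , [ n , refl ]}
        ( (λ eq → h-injective (cong value eq))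
        , strictlySurjective⇒surjective λ y →
            let (n , y≡hn) = satisfies {P = x} y in n , value-injective (sym y≡hn) )

      x-cofinal : ∀ {y} → y < β → ∃[ a ] a ∈ x × y < a
      x-cofinal {y} y<β =
        let (n , y≤fn) = f-cofinal (y , [ y<β ])
            (a , (_ , a<β) , _ , fn<a) = next n (proj₂ (proj₂ (h n)))
        -- The index is `suc n`, since `h (suc n)` is the point chosen above `f n`.
        in proj₁ (h (suc n)) , (suc n , refl) ,
           ≤-<-trans (O ↓ β) {k = a , [ a<β ]} y≤fn fn<a

    -- Increasing enumeration of a subset.

    module Enumeration (A : Pred X p) where

      Next : ∀ ξ → WfRec _<_ (λ _ → X) ξ → Pred X (ℓ ⊔ p)
      Next ξ prev a = a ∈ A × (∀ {ζ} (ζ<ξ : ζ < ξ) → prev ζ<ξ < a)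

      -- The value ξ is junk: it is taken only if no element of A is left.
      step : ∀ ξ → WfRec _<_ (λ _ → X) ξ → X
      step ξ prev with em {P = ∃ (IsLeast O (Next ξ prev))}
      ... | yes (a , _) = a
      ... | no _        = ξ

      step-least : ∀ ξ (prev : WfRec _<_ (λ _ → X) ξ) → ∃ (Next ξ prev) →
        IsLeast O (Next ξ prev) (step ξ prev)
      step-least ξ prev next with em {P = ∃ (IsLeast O (Next ξ prev))}
      ... | yes (_ , isLeast) = isLeast
      ... | no ¬least         = contradiction (least next) ¬least

      -- Required by `unfold-wfRec`. For pointwise equal histories `em` may return different
      -- witnesses, but leastness determines the element.
      step-ext : ∀ ξ {prev prev′ : WfRec _<_ (λ _ → X) ξ} →
        (∀ {ζ} ζ<ξ → prev {ζ} ζ<ξ ≡ prev′ ζ<ξ) → step ξ prev ≡ step ξ prev′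
      step-ext ξ {prev} {prev′} eq
        with em {P = ∃ (IsLeast O (Next ξ prev))} | em {P = ∃ (IsLeast O (Next ξ prev′))}
      ... | yes (_ , l) | yes (_ , l′) =
        least-unique O (Next-resp eq , Next-resp (λ ζ<ξ → sym (eq ζ<ξ))) l l′
        where
        Next-resp : ∀ {prev prev′ : WfRec _<_ (λ _ → X) ξ} →
          (∀ {ζ} ζ<ξ → prev {ζ} ζ<ξ ≡ prev′ ζ<ξ) → Next ξ prev ⊆ Next ξ prev′
        Next-resp eq (a∈A , prev<a) =
          a∈A , λ ζ<ξ → subst (_< _) (eq ζ<ξ) (prev<a ζ<ξ)
      ... | yes (a , (a∈A , prev<a) , _) | no ¬l′ = contradiction
        (least (a , a∈A , λ ζ<ξ → subst (_< a) (eq ζ<ξ) (prev<a ζ<ξ))) ¬l′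
      ... | no ¬l | yes (a , (a∈A , prev<a) , _) = contradiction
        (least (a , a∈A , λ ζ<ξ → subst (_< a) (sym (eq ζ<ξ)) (prev<a ζ<ξ))) ¬l
      ... | no _ | no _ = refl

      open All <-wellFounded using (wfRec)
      open FixPoint <-wellFounded (λ _ → X) step step-ext using (unfold-wfRec)

      enum : X → X
      enum = wfRec _ (λ _ → X) step

      IsNext : Pred X (ℓ ⊔ p)
      IsNext ξ = IsLeast O (Next ξ (λ {ζ} _ → enum ζ)) (enum ξ)

      -- Stopping at stage `ξ` means that all of `A` has been listed. For `A` of full size this
      -- contradicts `IsCardinal`.
      exhausted : ∀ {ξ} → (∀ {ζ} → ζ < ξ → IsNext ζ) →
        ¬ ∃ (Next ξ (λ {ζ} _ → enum ζ)) → Carrier (O ↓ ξ) ⤖ [ a ∈ X ∣ a ∈ A ]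
      exhausted {ξ} isNext stop = mk⤖ (injective , strictlySurjective⇒surjective surjective)
        where
        to : Carrier (O ↓ ξ) → [ a ∈ X ∣ a ∈ A ]
        to ζ = enum (value ζ) , [ proj₁ (proj₁ (isNext (satisfies ζ))) ]

        to-mono : ∀ ζ ζ′ → value ζ < value ζ′ → enum (value ζ) < enum (value ζ′)
        to-mono ζ ζ′ ζ<ζ′ = proj₂ (proj₁ (isNext (satisfies ζ′))) ζ<ζ′

        injective : Injective _≡_ _≡_ to
        injective {ζ} {ζ′} eq with compare (value ζ) (value ζ′)
        ... | tri< ζ<ζ′ _ _ = contradiction (to-mono ζ ζ′ ζ<ζ′) (irrefl (cong value eq))
        ... | tri≈ _ ζ≡ζ′ _ = value-injective ζ≡ζ′
        ... | tri> _ _ ζ′<ζ = contradiction (to-mono ζ′ ζ ζ′<ζ) (irrefl (sym (cong value eq)))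

        surjective : ∀ a → ∃[ ζ ] to ζ ≡ a
        surjective a =
          -- Some value reaches `a`, for otherwise `a` would be a candidate at stage `ξ`.
          let (ζ , ζ≮a) = ¬∀⇒∃¬ {P = λ (ζ : Carrier (O ↓ ξ)) → enum (value ζ) < value a}
                (λ enum<a → stop (value a , satisfies a , λ {ζ} ζ<ξ → enum<a (ζ , [ ζ<ξ ])))
              -- At the first such stage all earlier values lie below `a`, so `a` is a candidate
              -- there and leastness gives equality.
              (ζ₀ , (ζ₀<ξ , a≤ζ₀) , ζ₀≤) =
                least {P = λ ζ → ζ < ξ × value a ≤ enum ζ} (value ζ , satisfies ζ , ≮⇒≥ O ζ≮a)
              below : ∀ {ζ} → ζ < ζ₀ → enum ζ < value a
              below ζ<ζ₀ = dne λ ζ≮a →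
                ≤⇒≯ O (ζ₀≤ (trans ζ<ζ₀ ζ₀<ξ , ≮⇒≥ O ζ≮a)) ζ<ζ₀
          in (ζ₀ , [ ζ₀<ξ ]) , value-injective
               (≤-antisym O (proj₂ (isNext ζ₀<ξ) (satisfies a , below)) a≤ζ₀)

      module _ (cardinal : IsCardinal O) (size : HasSize A X) where

        enum-isNext : ∀ ξ → IsNext ξ
        enum-isNext = wfRec _ IsNext λ ξ IH →
          subst (IsLeast O (Next ξ (λ {ζ} _ → enum ζ))) (sym unfold-wfRec)
            (step-least ξ _ (dne λ stop → cardinal ξ (size ⤖-∘ exhausted IH stop)))

        enum-∈ : ∀ ξ → enum ξ ∈ A
        enum-∈ ξ = proj₁ (proj₁ (enum-isNext ξ))

        enum-mono : enum Preserves _<_ ⟶ _<_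
        enum-mono {_} {ξ} = proj₂ (proj₁ (enum-isNext ξ))

  -- Suprema of strictly increasing sequences.

  module _ (D : Ordinal ℓ₁) (O : Ordinal ℓ₂) (e : Carrier D → Carrier O)
           (e-mono : e Preserves Ordinal._<_ D ⟶ Ordinal._<_ O)
           (s : Carrier O) (e-sup : StrictSup O e s) where
    open Ordinal O using (_<_)

    -- Replacing each value of a shorter map cofinal in `s` by an index whose `e`-value dominates it
    -- would give a shorter map cofinal in `D`.
    strictSup-cofinality : HasCofinality D D → HasCofinality (O ↓ s) D
    strictSup-cofinality (_ , D-regular) = (e′ , index) , λ ξ (g , g-cofinal) →
      D-regular ξ (proj₁ ∘ index ∘ g , λ ζ →
        let (i , eζ≤gi) = g-cofinal (e′ ζ)
            (j , gi≤ej) = index (g i)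
        in i , ≮⇒≥ D λ j<ζ → ≤⇒≯ (O ↓ s) (≤-trans (O ↓ s) eζ≤gi gi≤ej) (e-mono j<ζ))
      where
      e′ : Carrier D → Carrier (O ↓ s)
      e′ ξ = e ξ , [ proj₁ e-sup ξ ]

      index : ∀ y → ∃[ ξ ] Ordinal._≤_ (O ↓ s) y (e′ ξ)
      index y =
        let (ξ , y≤eξ) = strictSup-cofinal O e-sup (satisfies y)
        in ξ , ≮⇒≥ (O ↓ s) (≤⇒≯ O y≤eξ)

    -- Starting above `b`, take an increasing ω-sequence `h` in `D`. It is bounded in `D`, so the
    -- supremum `z` of the `e (h n)` stays below `s`, and the points `e (h n)` of `A` converge to
    -- it.
    limitPoints-unbounded : ¬ CofinalMap ω D → (A : Pred (Carrier O) p) →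
      (∀ ξ → e ξ ∈ A) → Unbounded (O ↓ s) (LimitPoint O A ∘ value)
    limitPoints-unbounded ¬cofinal A e∈A b =
      (z , [ z<s ]) , z-limit , inj₁ (≤-<-trans O b≤eξ (proj₁ z-sup 0))
      where
      bound : ∀ (h : ℕ → Carrier D) → ∃[ y ] (∀ n → Ordinal._<_ D (h n) y)
      bound h =
        let (y , ¬y≤h) = ¬∀⇒∃¬ {P = λ y → ∃[ n ] Ordinal._≤_ D y (h n)} (λ c → ¬cofinal (h , c))
        in y , λ n → dne λ hn≮y → ¬y≤h (n , ≮⇒≥ D hn≮y)

      ξ,b≤eξ = strictSup-cofinal O e-sup (satisfies b)
      b≤eξ = proj₂ ξ,b≤eξ

      h : ℕ → Carrier D
      h zero    = proj₁ ξ,b≤eξ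
      -- The bound of a constant sequence is simply a strictly larger index.
      h (suc n) = proj₁ (bound (λ _ → h n))

      z,z-sup = least O {P = λ y → ∀ n → e (h n) < y}
        (e (proj₁ (bound h)) , λ n → e-mono (proj₂ (bound h) n))
      z = proj₁ z,z-sup
      z-sup = proj₂ z,z-sup

      z<s : z < s
      z<s = ≤-<-trans O (proj₂ z-sup (λ n → e-mono (proj₂ (bound h) n)))
        (proj₁ e-sup (proj₁ (bound h)))

      z-limit : LimitPoint O A z
      z-limit y<z =
        let (n , y≤ehn) = strictSup-cofinal O z-sup y<z
        in e (h (suc n)) , e∈A _ ,
           ≤-<-trans O y≤ehn (e-mono (proj₂ (bound (λ _ → h n)) n)) , proj₁ z-sup (suc n)

  -- Send y to the largest of h 0, …, h n, where n is least with y ≤ f n; sending y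
  -- to h n would not suffice, as y ↦ n may miss the indices of large values of h.
  cofinalMap-from-cofinality-ω : (P : Ordinal ℓ₁) (D : Ordinal ℓ₂) →
    HasCofinality P ω → CofinalMap ω D → CofinalMap P D
  cofinalMap-from-cofinality-ω P D ((f , f-cofinal) , minimal) (h , h-cofinal) =
    h̄ ∘ proj₁ ∘ index , λ d →
      let (n , d≤hn) = h-cofinal d
          -- Minimality of ω: the values of `f` at arguments below `n` are not cofinal, so some `y`
          -- exceeds them all and has index at least `n`.
          (y , f<y)  = ¬∀⇒∃¬ {P = λ y → ∃[ ξ ] Ordinal._≤_ P y (f (value {P = ℕ._< n} ξ))}
                         (λ c → minimal n (f ∘ value , c))
          (m , y≤fm , _) = index y
      in y , ≤-trans D (≤-trans D d≤hn (h≤h̄ n))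
               (h̄-mono (≮⇒≥ ω λ m<n → f<y ((m , [ m<n ]) , y≤fm)))
    where
    open Ordinal D using (_≤_)

    index : ∀ y → ∃ (IsLeast ω (λ n → Ordinal._≤_ P y (f n)))
    index y = least ω (f-cofinal y)

    h̄ : ℕ → Carrier D
    h̄ zero    = h 0
    h̄ (suc n) = proj₁ (upperBound D (h̄ n) (h (suc n)))

    h≤h̄ : ∀ n → h n ≤ h̄ n
    h≤h̄ zero    = inj₂ refl
    h≤h̄ (suc n) = proj₂ (proj₂ (upperBound D (h̄ n) (h (suc n))))

    h̄-mono : ∀ {m n} → Ordinal._≤_ ω m n → h̄ m ≤ h̄ n
    h̄-mono (inj₁ m<n)  = mono-from-steps _≤_ (≤-trans D) {h̄}
      (λ n → proj₁ (proj₂ (upperBound D (h̄ n) (h (suc n))))) m<n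
    h̄-mono (inj₂ refl) = inj₂ refl

  -- Colours realised in sets of full size.

  module _ (κ : Ordinal ℓ) (cardinal : IsCardinal κ) where
    open Ordinal κ using (_<_; trans)

    -- A point of cofinality ω below `δ` would convert the cofinal ω-sequence in `δ` into a cofinal
    -- map from a proper initial segment, against regularity.
    cofinality-ω-below : {δ : Carrier κ} → HasCofinality (κ ↓ δ) (κ ↓ δ) →
      CofinalMap ω (κ ↓ δ) → (x : Carrier (κ ↓ δ)) → ¬ HasCofinality (κ ↓ value x) ω
    cofinality-ω-below {δ} (_ , regular) countable x cf-x = regular x
      (cofinalMap-∘-surjective (κ ↓ δ ↓ x) (κ ↓ value x) (κ ↓ δ)
        (cofinalMap-from-cofinality-ω (κ ↓ value x) (κ ↓ δ) cf-x countable)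
        (λ y → value (value y) , [ satisfies y ])
        (λ y → ((value y , [ trans (satisfies y) (satisfies x) ]) , [ satisfies y ]) , refl))

    omits-no-colour : {δ : Carrier κ} → IsRegularCardinal (κ ↓ δ) →
      ((T , _) : Quilshon κ (CofinalityOmega κ) δ) →
      (A : Pred (Carrier κ) ℓ) → HasSize A (Carrier κ) → ∀ γ →
      Σ[ x ∈ Pred (Carrier κ) ℓ ] IsBddCtbl κ x × x ⊆ A × ∃[ β ] β ∈ T γ × LimitSup κ x β
    omits-no-colour {δ} (_ , _ , cf-δ) (T , T⊆S , _ , stationary) A size γ
      with em {P = CofinalMap ω (κ ↓ δ)}
    ... | yes countable =
      -- As `δ` is its own cofinality, stationarity applies at `δ` itself; the club is all of `δ`.
      let (x , x∈T , _) = stationary δ cf-δ γ (λ _ → ⊤)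
                            (λ b → b , _ , inj₂ refl) (λ _ _ _ → _)
      in contradiction (T⊆S γ x∈T) (cofinality-ω-below cf-δ countable x)
    ... | no ¬countable =
      let open Enumeration κ A
          e : Carrier (κ ↓ δ) → Carrier κ
          e ξ = enum (value ξ)
          -- The first `δ` elements of `A` are bounded by the next one, `enum δ`.
          (η , η-sup) = least κ {P = λ y → ∀ ξ → e ξ < y}
            (enum δ , λ ξ → enum-mono cardinal size (satisfies ξ))
          (β , β∈T , limit) = stationary η
            (strictSup-cofinality (κ ↓ δ) κ e (enum-mono cardinal size) η η-sup cf-δ) γ
            (LimitPoint κ A ∘ value)
            (limitPoints-unbounded (κ ↓ δ) κ e (enum-mono cardinal size) η η-sup ¬countable A
              (enum-∈ cardinal size ∘ value))
            (limitPoints-closed κ η A)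
          -- `T γ ⊆ S` supplies the cofinality ω of `β`.
          (x , x-size , x⊆A , x-sup) = limitPoint⇒limitSup κ A limit (T⊆S γ β∈T)
      in x , (x-size , value β , proj₁ x-sup) , x⊆A , value β , β∈T , x-sup

-- The colouring by suprema.

theorem3p2 : (∀ {a : Level} → ExcludedMiddle a) →
    ∀ {ℓ : Level} (κ : Ordinal ℓ) → ω ≺ κ → IsMagidor κ →
    ∀ (αM : Ordinal.Carrier κ) → IsLeastArrowed κ αM →
    ∀ (δ : Ordinal.Carrier κ) → IsRegularCardinal (κ ↓ δ) → Ordinal._≤_ κ αM δ →
    ¬ Quilshon κ (CofinalityOmega κ) δ
theorem3p2 em {ℓ} κ _ (cardinal , _) αM ((ξ₀ , ξ₀<αM) , arrows , _) δ regular αM≤δ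
  quilshon@(T , _ , T-disjoint , _) =
  let (A , size , omits) = arrows colouring
  in omits ((λ _ → _) , λ {θ} _ →
    let (x , bdd , x⊆A , β , β∈T , x-sup) =
          omits-no-colour κ cardinal regular quilshon A size (ι θ)
    in (x , bdd) , x⊆A , colour-unique x θ (β , β∈T , x-sup))
  where
  open Classical em

  -- Here `αM ≤ δ` enters: each colour is also an index of the family.
  ι : Carrier (κ ↓ αM) → Carrier (κ ↓ δ)
  ι = inclusion κ αM≤δ

  HasColour : Pred (Carrier κ) ℓ → Pred (Carrier (κ ↓ αM)) ℓ
  HasColour x θ = ∃[ β ] β ∈ T (ι θ) × LimitSup κ x β

  -- The set `x` determines its supremum, and by disjointness at most one `T γ` contains it.
  hasColour-unique : ∀ x θ θ′ → HasColour x θ → HasColour x θ′ → θ ≡ θ′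
  hasColour-unique _ _ _ (β , β∈T , β-sup) (β′ , β′∈T , β′-sup)
    with refl ← limitSup-unique κ β-sup β′-sup =
    dne λ θ≢θ′ → T-disjoint _ _ (λ eq → θ≢θ′ (value-injective (cong value eq))) (β∈T , β′∈T)

  hasColour-resp : ∀ x y → x ≐ y → ∀ θ → HasColour x θ → HasColour y θ
  hasColour-resp _ _ (x⊆y , y⊆x) _ (β , β∈T , bound , cofinal) =
    β , β∈T , bound ∘ y⊆x , λ b<β → let (a , a∈x , b<a) = cofinal b<β in a , x⊆y a∈x , b<a

  colour : Pred (Carrier κ) ℓ → Carrier (κ ↓ αM)
  colour x with em {P = ∃ (HasColour x)}
  ... | yes (θ , _) = θ
  -- A default colour, available because `αM` is nonzero.
  ... | no _        = ξ₀ , [ ξ₀<αM ]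

  colour-unique : ∀ x θ → HasColour x θ → colour x ≡ θ
  colour-unique x θ c with em {P = ∃ (HasColour x)}
  ... | yes (θ′ , c′) = hasColour-unique x θ′ θ c′ c
  ... | no ¬c         = contradiction (θ , c) ¬c

  -- `em` decides the two sets separately and may return different witnesses; uniqueness of the
  -- colour reconciles them.
  colour-cong : ∀ x y → x ≐ y → colour x ≡ colour y
  colour-cong x y x≐y with em {P = ∃ (HasColour y)}
  ... | yes (θ , c) = colour-unique x θ (hasColour-resp y x (swap x≐y) θ c)
  ... | no ¬c with em {P = ∃ (HasColour x)}
  ...   | yes (θ , c) = contradiction (θ , hasColour-resp x y x≐y θ c) ¬c
  ...   | no _        = refl

  colouring : Colouring κ (κ ↓ αM)
  colouring = record { to = colour ∘ proj₁ ; cong = colour-cong _ _ }
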